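{- Let $D=(V,A)$ be a weak path on $n\ge 1$ vertices, with vertices labeled in order from one end-vertex to the other as $v_1,v_2,\dots,v_n$. Let $$V_-=\{v_1\}\cup\{v_k: (v_k,v_{k-1})\in A\text{ and }(v_{k-1},v_k)\notin A\},$$ $$V_+=\{v_n\}\cup\{v_k: (v_k,v_{k+1})\in A\text{ and }(v_{k+1},v_k)\notin A\},$$ and let $\ell=\min\{i-j: v_j\in V_-,\ v_i\in V_+,\ i-j\ge 0\}$. Then $$F(D)=n-1-\left\lceil\frac{\ell}{2}\right\rceil.$$
   Context: A finite simple digraph $D=(V,A)$ has finite nonempty vertex set $V$ and arc set $A$ consisting of ordered pairs of distinct vertices (no loops, no parallel arcs; both $(u,v)$ and $(v,u)$ may be present). $N_D^+(v)=\{u:(v,u)\in A\}$. A weak path is a digraph whose underlying undirected graph (replace each arc $(u,v)$ by the edge $\{u,v\}$) is a path; thus consecutive vertices $v_i,v_{i+1}$ are joined by one or both of the arcs $(v_i,v_{i+1}),(v_{i+1},v_i)$, and there are no other arcs. The single vertex $K_1$ and digraphs with underlying graph $K_2$ are included. Zero forcing: for $S\subseteq V$ let $B^0(S)=S$ and $B^{i+1}(S)=B^i(S)\cup\{w:\{w\}=N_D^+(v)\setminus B^i(S)\text{ for some }v\in B^i(S)\}$. $S$ is a zero forcing set (ZFS) if $B^t(S)=V$ for some $t\ge 0$, and a failed zero forcing set (FZFS) otherwise. The failed zero forcing number $F(D)$ is the largest cardinality of an FZFS of $D$. -}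

module Defs where

open import Level using (0ℓ)
open import Data.Bool.Properties using () renaming (_≟_ to _≟ᵇ_)
open import Data.Nat using (ℕ; zero; suc; _≤_; _∸_)
open import Data.Fin using (Fin; toℕ)
open import Data.Fin.Permutation using (Permutation′; _⟨$⟩ʳ_)
open import Data.Fin.Properties using (any?)
open import Data.Fin.Subset using (Subset; _∈_; _∪_; _─_; ⁅_⁆; ⊤; ∣_∣)
open import Data.Fin.Subset.Properties using (_∈?_)
open import Data.Product using (∃; ∃₂; ∃-syntax; _×_; _,_)
open import Data.Sum using (_⊎_)
open import Data.Vec using (tabulate)
open import Data.Vec.Properties using (≡-dec)
open import Function using (_∘_)
open import Function.Bundles using (_⇔_)
open import Relation.Binary.Core using (Rel)
open import Relation.Binary.Definitions using (Decidable; DecidableEquality)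
open import Relation.Binary.PropositionalEquality using (_≡_)
open import Relation.Nullary using (¬_; does)
open import Relation.Nullary.Decidable using (_×-dec_)
open import Relation.Unary using (Pred) renaming (Decidable to Decidable₁)

-- Nonemptiness of the vertex set is `NonZero n`, imposed where it is needed.
record Digraph (n : ℕ) : Set₁ where
  infix 4 _⟶_ _⟶?_
  field
    _⟶_      : Rel (Fin n) 0ℓ
    _⟶?_     : Decidable _⟶_
    loopless : ∀ v → ¬ (v ⟶ v)

comprehension : ∀ {n} {P : Pred (Fin n) 0ℓ} → Decidable₁ P → Subset n
comprehension P? = tabulate (does ∘ P?)

_≟ˢ_ : ∀ {n} → DecidableEquality (Subset n)
_≟ˢ_ = ≡-dec _≟ᵇ_

IsMaximum : Pred ℕ 0ℓ → ℕ → Set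
IsMaximum P m = P m × (∀ k → P k → k ≤ m)

IsMinimum : Pred ℕ 0ℓ → ℕ → Set
IsMinimum P m = P m × (∀ k → P k → m ≤ k)

module _ {n : ℕ} (D : Digraph n) where
  open Digraph D

  N⁺ : Fin n → Subset n
  N⁺ v = comprehension (v ⟶?_)

  Forced : Subset n → Pred (Fin n) 0ℓ
  Forced S w = ∃[ v ] (v ∈ S × ⁅ w ⁆ ≡ N⁺ v ─ S)

  forced? : (S : Subset n) → Decidable₁ (Forced S)
  forced? S w = any? λ v → (v ∈? S) ×-dec (⁅ w ⁆ ≟ˢ (N⁺ v ─ S))

  B : ℕ → Subset n → Subset n
  B zero    S = S
  B (suc i) S = B i S ∪ comprehension (forced? (B i S))

  IsZFS : Subset n → Set
  IsZFS S = ∃[ t ] B t S ≡ ⊤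

  IsFZFS : Subset n → Set
  IsFZFS S = ¬ IsZFS S

  -- The graph of the function F, since deciding IsFZFS takes an argument:
  -- F(D) = m.
  IsFailedZeroForcingNumber : ℕ → Set
  IsFailedZeroForcingNumber =
    IsMaximum λ m → ∃[ S ] (IsFZFS S × ∣ S ∣ ≡ m)

  Adjacent : Rel (Fin n) 0ℓ
  Adjacent u w = (u ⟶ w) ⊎ (w ⟶ u)

  -- A labelling v lists the vertices as v₁, …, vₙ; the index k : Fin n stands
  -- for the one-based label toℕ k + 1.
  IsWeakPath : Permutation′ n → Set
  IsWeakPath v = ∀ i j →
    Adjacent (v ⟨$⟩ʳ i) (v ⟨$⟩ʳ j) ⇔ (toℕ j ≡ suc (toℕ i) ⊎ toℕ i ≡ suc (toℕ j))

  module _ (v : Permutation′ n) where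

    OneWay : Rel (Fin n) 0ℓ
    OneWay k k′ = (v ⟨$⟩ʳ k ⟶ v ⟨$⟩ʳ k′) × ¬ (v ⟨$⟩ʳ k′ ⟶ v ⟨$⟩ʳ k)

    V₋ V₊ : Pred (Fin n) 0ℓ
    V₋ x = ∃[ k ] (x ≡ v ⟨$⟩ʳ k ×
      (toℕ k ≡ 0 ⊎ ∃[ k′ ] (suc (toℕ k′) ≡ toℕ k × OneWay k k′)))
    V₊ x = ∃[ k ] (x ≡ v ⟨$⟩ʳ k ×
      (suc (toℕ k) ≡ n ⊎ ∃[ k′ ] (toℕ k′ ≡ suc (toℕ k) × OneWay k k′)))

    Gap : Pred ℕ 0ℓ
    Gap d = ∃₂ λ j i →
      V₋ (v ⟨$⟩ʳ j) × V₊ (v ⟨$⟩ʳ i) × toℕ j ≤ toℕ i × d ≡ toℕ i ∸ toℕ j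

{-# OPTIONS --safe #-}
-- The complement W of a stalled set is a fort: no vertex outside W has exactly
-- one out-neighbour in W.  Hence F(D) is n minus the least size of a nonempty
-- fort.  Starting from a vertex of a fort on a weak path and walking right, we
-- can always advance by one or two steps to another vertex of the fort, until
-- we reach V₊; walking left from there we reach V₋ in the same way.  So the
-- fort contains every other vertex between some v_j in V₋ and some v_i in V₊,
-- and has at least 1 + ⌈(i - j)/2⌉ elements.  Conversely, when i - j = ℓ is
-- minimal all arcs between v_j and v_i are two-way, so that
-- {v_j, v_{j+2}, …} ∪ {v_i} is a fort of size 1 + ⌈ℓ/2⌉.
module Submission where

open import Data.Nat
  using (ℕ; zero; suc; _+_; _≤_; _<_; _∸_; ⌈_/2⌉; NonZero; z≤n; s≤s; s≤s⁻¹; _<?_)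
open import Data.Nat.Properties
  using (≤-refl; ≤-reflexive; ≤-trans; ≤-antisym; +-mono-≤; <-trans; <-irrefl; <⇒≤; <⇒≱; n<1+n; n≤1+n;
         m≤n⇒m<n∨m≡n; m≤n+m; m<n⇒m<1+n; ≤-<-trans; <-≤-trans; suc-injective; +-suc;
         m+n∸n≡m; m∸n+n≡m; m∸[m∸n]≡n; ∸-monoˡ-<; ∸-monoʳ-<; ∸-monoʳ-≤; ∸-+-assoc; ⌈n/2⌉-mono; ⌊n/2⌋≤⌈n/2⌉;
         m≤n⇒m≤1+n; m≤m+n; module ≤-Reasoning)
open import Data.Nat.DivMod using (_mod_; m%n<n; m<n⇒m%n≡m)
open import Data.Fin using (Fin; toℕ)
open import Data.Fin.Permutation using (Permutation′; _⟨$⟩ʳ_; _⟨$⟩ˡ_; inverseˡ; inverseʳ)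
open import Data.Fin.Properties using (any?; toℕ<n; toℕ-fromℕ<; toℕ-injective)
  renaming (_≟_ to _≟ᶠ_)
open import Data.Fin.Subset
  using (Subset; inside; outside; _∈_; _∉_; _⊆_; _∪_; _─_; ∁; ⁅_⁆; ⊤; ∣_∣)
open import Data.Fin.Subset.Properties
  using (_∈?_; ∈⊤; ⊆⊤; x∈⁅x⁆; x∈⁅y⁆⇒x≡y; ∣⁅x⁆∣≡1; ⊆-antisym; ∣p∣≤n; p⊆q⇒∣p∣≤∣q∣; p⊂q⇒∣p∣<∣q∣;
         x∈∁p⇒x∉p; x∉∁p⇒x∈p; x∉p⇒x∈∁p; ∣∁p∣≡n∸∣p∣; p⊆p∪q; q⊆p∪q; x∈p∪q⁻;
         p─q⊆p; x∈p∧x∉q⇒x∈p─q; x∈p⇒∣p-x∣<∣p∣)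
open import Data.Product using (∃₂; ∃-syntax; _×_; _,_; proj₁; proj₂)
open import Data.Sum using (_⊎_; inj₁; inj₂; [_,_]′)
open import Data.Vec using (_∷_; []; here; there)
open import Data.Vec.Properties using (lookup∘tabulate; []=⇒lookup; lookup⇒[]=)
open import Function using (_∘_; Equivalence)
open import Level using (0ℓ)
open import Relation.Binary.PropositionalEquality
  using (_≡_; _≢_; refl; sym; trans; cong; cong₂; subst)
open import Relation.Nullary using (¬_; does; yes; no; contradiction; ¬?)
open import Relation.Nullary.Decidable using (_×-dec_; dec-true)
open import Relation.Unary using (Pred) renaming (Decidable to Decidable₁)
open import Defs

-- Arithmetic and finite subsets

m+2+n≡2+m+n : ∀ m n → m + suc (suc n) ≡ suc (suc (m + n))
m+2+n≡2+m+n m n = trans (+-suc m (suc n)) (cong suc (+-suc m n))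

∈-comprehension⁺ : ∀ {n} {P : Pred (Fin n) 0ℓ} (P? : Decidable₁ P) {x} →
  P x → x ∈ comprehension P?
∈-comprehension⁺ P? {x} px =
  lookup⇒[]= x _ (trans (lookup∘tabulate (does ∘ P?) x) (dec-true (P? x) px))

∈-comprehension⁻ : ∀ {n} {P : Pred (Fin n) 0ℓ} (P? : Decidable₁ P) {x} →
  x ∈ comprehension P? → P x
∈-comprehension⁻ P? {x} x∈ with P? x | trans (sym (lookup∘tabulate (does ∘ P?) x)) ([]=⇒lookup x∈)
... | yes px | _ = px
... | no _   | ()

x∈p─q⇒x∉q : ∀ {n} {x : Fin n} (p q : Subset n) → x ∈ p ─ q → x ∉ q
x∈p─q⇒x∉q (inside  ∷ p) (inside  ∷ q) ()        here
x∈p─q⇒x∉q (outside ∷ p) (inside  ∷ q) ()        here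
x∈p─q⇒x∉q (_       ∷ p) (_       ∷ q) (there a) (there b) = x∈p─q⇒x∉q p q a b

∣p∪q∣≤∣p∣+∣q∣ : ∀ {n} (p q : Subset n) → ∣ p ∪ q ∣ ≤ ∣ p ∣ + ∣ q ∣
∣p∪q∣≤∣p∣+∣q∣ []            []            = z≤n
∣p∪q∣≤∣p∣+∣q∣ (outside ∷ p) (outside ∷ q) = ∣p∪q∣≤∣p∣+∣q∣ p q
∣p∪q∣≤∣p∣+∣q∣ (outside ∷ p) (inside  ∷ q)
  rewrite +-suc ∣ p ∣ ∣ q ∣ = s≤s (∣p∪q∣≤∣p∣+∣q∣ p q)
∣p∪q∣≤∣p∣+∣q∣ (inside  ∷ p) (outside ∷ q) = s≤s (∣p∪q∣≤∣p∣+∣q∣ p q)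
∣p∪q∣≤∣p∣+∣q∣ (inside  ∷ p) (inside  ∷ q)
  rewrite +-suc ∣ p ∣ ∣ q ∣ = s≤s (m≤n⇒m≤1+n (∣p∪q∣≤∣p∣+∣q∣ p q))

-- Forts and stalled sets

module _ {n} (D : Digraph n) where
  open Digraph D

  Fort : Subset n → Set
  Fort W = ∀ {u x} → u ∉ W → u ⟶ x → x ∈ W → ∃[ y ] (y ≢ x × u ⟶ y × y ∈ W)

  Stalled : Subset n → Set
  Stalled S = ∀ {w} → Forced D S w → w ∈ S

  forced⁺ : ∀ {S u x} → u ∈ S → u ⟶ x → x ∉ S →
    (∀ {y} → u ⟶ y → y ∉ S → y ≡ x) → Forced D S x
  forced⁺ {S} {u} {x} u∈S u⟶x x∉S only = u , u∈S , ⊆-antisym sub sup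
    where
    sub : ⁅ x ⁆ ⊆ N⁺ D u ─ S
    sub y∈ with x∈⁅y⁆⇒x≡y x y∈
    ... | refl = x∈p∧x∉q⇒x∈p─q (∈-comprehension⁺ (u ⟶?_) u⟶x) x∉S
    sup : N⁺ D u ─ S ⊆ ⁅ x ⁆
    sup {y} y∈ with only (∈-comprehension⁻ (u ⟶?_) (p─q⊆p _ S y∈)) (x∈p─q⇒x∉q (N⁺ D u) S y∈)
    ... | refl = x∈⁅x⁆ x

  -- A vertex of `S` with a single out-neighbour outside `S` would force it. The second
  -- out-neighbour is found by a finite search.
  stalled⇒fort : ∀ {S} → Stalled S → Fort (∁ S)
  stalled⇒fort {S} stalled {u} {x} u∉ u⟶x x∈
    with any? (λ y → ¬? (y ≟ᶠ x) ×-dec (u ⟶? y) ×-dec (y ∈? ∁ S))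
  ... | yes y = y
  ... | no ∄y = contradiction
        (stalled (forced⁺ (x∉∁p⇒x∈p u∉) u⟶x (x∈∁p⇒x∉p x∈) only)) (x∈∁p⇒x∉p x∈)
    where
    only : ∀ {y} → u ⟶ y → y ∉ S → y ≡ x
    only {y} u⟶y y∉S with y ≟ᶠ x
    ... | yes eq = eq
    ... | no y≢x = contradiction (y , y≢x , u⟶y , x∉p⇒x∈∁p y∉S) ∄y

  fort⇒stalled : ∀ {W} → Fort W → Stalled (∁ W)
  fort⇒stalled {W} fort {w} (u , u∈S , eq) = x∉p⇒x∈∁p w∉W
    where
    w∈N─S : w ∈ N⁺ D u ─ ∁ W
    w∈N─S = subst (w ∈_) eq (x∈⁅x⁆ w)
    w∉W : w ∉ W
    w∉W w∈W with fort (x∈∁p⇒x∉p u∈S) (∈-comprehension⁻ (u ⟶?_) (p─q⊆p _ (∁ W) w∈N─S)) w∈W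
    ... | y , y≢w , u⟶y , y∈W = y≢w (x∈⁅y⁆⇒x≡y w (subst (y ∈_) (sym eq)
            (x∈p∧x∉q⇒x∈p─q (∈-comprehension⁺ (u ⟶?_) u⟶y) (λ y∈∁ → x∈∁p⇒x∉p y∈∁ y∈W))))

  stalled⇒B-fixed : ∀ {S} → Stalled S → ∀ t → B D t S ≡ S
  stalled⇒B-fixed stalled zero = refl
  stalled⇒B-fixed {S} stalled (suc t) rewrite stalled⇒B-fixed stalled t =
    ⊆-antisym (λ x∈ → [ (λ x∈S → x∈S) , stalled ∘ ∈-comprehension⁻ (forced? D S) ]′ (x∈p∪q⁻ S _ x∈))
              (p⊆p∪q _)

  fort⇒FZFS : ∀ {W x} → Fort W → x ∈ W → IsFZFS D (∁ W)
  fort⇒FZFS {W} {x} fort x∈W (t , Bt≡⊤) = x∈∁p⇒x∉p x∈∁W x∈W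
    where
    x∈∁W : x ∈ ∁ W
    x∈∁W = subst (x ∈_) (trans (sym Bt≡⊤) (stalled⇒B-fixed (fort⇒stalled fort) t)) ∈⊤

  S⊆B : ∀ t {S} → S ⊆ B D t S
  S⊆B zero    x∈ = x∈
  S⊆B (suc t) x∈ = p⊆p∪q _ (S⊆B t x∈)

  -- Every round that does not stall adds a vertex, so the round number bounds the size from below.
  grows-or-stalls : ∀ S t → t ≤ ∣ B D t S ∣ ⊎ ∃[ s ] Stalled (B D s S)
  grows-or-stalls S zero = inj₁ z≤n
  grows-or-stalls S (suc t) with grows-or-stalls S t
  ... | inj₂ stalls = inj₂ stalls
  ... | inj₁ t≤ with any? (λ w → forced? D (B D t S) w ×-dec ¬? (w ∈? B D t S))
  ...   | yes (w , forced , w∉) = inj₁ (≤-<-trans t≤ (p⊂q⇒∣p∣<∣q∣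
            (p⊆p∪q _ , w , q⊆p∪q (B D t S) _ (∈-comprehension⁺ (forced? D (B D t S)) forced) , w∉)))
  ...   | no ∄w = inj₂ (t , stalled)
    where
    stalled : Stalled (B D t S)
    stalled {w} forced with w ∈? B D t S
    ... | yes w∈ = w∈
    ... | no w∉  = contradiction (w , forced , w∉) ∄w

  stalls : ∀ S → ∃[ s ] Stalled (B D s S)
  -- After `suc n` rounds, growth alone would exceed the `n` available vertices.
  stalls S with grows-or-stalls S (suc n)
  ... | inj₁ n< = contradiction (∣p∣≤n (B D (suc n) S)) (<⇒≱ n<)
  ... | inj₂ st = st

≢⊤⇒∁-nonempty : ∀ {n} {S : Subset n} → S ≢ ⊤ → ∃[ x ] x ∈ ∁ S
≢⊤⇒∁-nonempty {S = S} S≢⊤ with any? (_∈? ∁ S)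
... | yes x = x
... | no ∄x = contradiction (⊆-antisym ⊆⊤ (λ {x} _ → x∉∁p⇒x∈p (λ x∈ → ∄x (x , x∈)))) S≢⊤

-- Weak paths

module WeakPath {n} .{{_ : NonZero n}} (D : Digraph n) (v : Permutation′ n)
                (path : IsWeakPath D v) where
  open Digraph D

  -- Positions count from 0 and wrap around at n.
  at : ℕ → Fin n
  at k = v ⟨$⟩ʳ (k mod n)

  pos : Fin n → ℕ
  pos x = toℕ (v ⟨$⟩ˡ x)

  toℕ-mod : ∀ {k} → k < n → toℕ (k mod n) ≡ k
  toℕ-mod {k} k<n = trans (toℕ-fromℕ< (m%n<n k n)) (m<n⇒m%n≡m k<n)

  toℕ-at : ∀ i → at (toℕ i) ≡ v ⟨$⟩ʳ i
  toℕ-at i = cong (v ⟨$⟩ʳ_) (toℕ-injective (toℕ-mod (toℕ<n i)))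

  pos-at : ∀ {k} → k < n → pos (at k) ≡ k
  pos-at k<n = trans (cong toℕ (inverseˡ v)) (toℕ-mod k<n)

  locate : ∀ x → ∃[ k ] (k < n × x ≡ at k)
  locate x = pos x , toℕ<n _ , sym (trans (toℕ-at (v ⟨$⟩ˡ x)) (inverseʳ v))

  at-injective : ∀ {k l} → k < n → l < n → at k ≡ at l → k ≡ l
  at-injective k<n l<n eq = trans (sym (pos-at k<n)) (trans (cong pos eq) (pos-at l<n))

  adjacent⇒consecutive : ∀ {k l} → k < n → l < n → Adjacent D (at k) (at l) →
    l ≡ suc k ⊎ k ≡ suc l
  adjacent⇒consecutive {k} {l} k<n l<n adj
    with Equivalence.to (path (k mod n) (l mod n)) adj
  ... | eq rewrite toℕ-mod k<n | toℕ-mod l<n = eq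

  consecutive⇒adjacent : ∀ {k} → suc k < n → Adjacent D (at k) (at (suc k))
  consecutive⇒adjacent {k} k+1<n = Equivalence.from (path (k mod n) (suc k mod n))
    (inj₁ (trans (toℕ-mod k+1<n) (cong suc (sym (toℕ-mod (<-trans (n<1+n k) k+1<n))))))

  -- These express `V₋` and `V₊` by position. Consecutive vertices are adjacent, so a missing arc
  -- towards `k` leaves only the opposite arc; at an end of the path the condition is vacuous.
  LeftBlocked RightBlocked : ℕ → Set
  LeftBlocked  k = ∀ {k′} → k ≡ suc k′ → ¬ (at k′ ⟶ at k)
  RightBlocked k = suc k < n → ¬ (at (suc k) ⟶ at k)

  ⟨$⟩ʳ-injective : ∀ {i j} → v ⟨$⟩ʳ i ≡ v ⟨$⟩ʳ j → i ≡ j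
  ⟨$⟩ʳ-injective eq = trans (sym (inverseˡ v)) (trans (cong (v ⟨$⟩ˡ_) eq) (inverseˡ v))

  V₋⇒LeftBlocked : ∀ {i} → V₋ D v (v ⟨$⟩ʳ i) → LeftBlocked (toℕ i)
  V₋⇒LeftBlocked (k , eq , cond) {k′} i≡ with ⟨$⟩ʳ-injective eq
  ... | refl with cond
  ...   | inj₁ i≡0 = contradiction (trans (sym i≡0) i≡) λ ()
  ...   | inj₂ (l , l+1≡i , _ , ¬arc) rewrite sym (suc-injective (trans l+1≡i i≡))
            | toℕ-at k | toℕ-at l = ¬arc

  V₊⇒RightBlocked : ∀ {i} → V₊ D v (v ⟨$⟩ʳ i) → RightBlocked (toℕ i)
  V₊⇒RightBlocked (k , eq , cond) i+1<n with ⟨$⟩ʳ-injective eq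
  ... | refl with cond
  ...   | inj₁ i+1≡n = contradiction i+1<n (<-irrefl i+1≡n)
  ...   | inj₂ (l , l≡i+1 , _ , ¬arc) rewrite sym l≡i+1 | toℕ-at k | toℕ-at l = ¬arc

  LeftBlocked⇒V₋ : ∀ {k} → k < n → LeftBlocked k → V₋ D v (at k)
  LeftBlocked⇒V₋ {zero}  k<n _       = zero mod n , refl , inj₁ (toℕ-mod k<n)
  LeftBlocked⇒V₋ {suc k} k<n blocked = suc k mod n , refl ,
      inj₂ (k mod n , trans (cong suc (toℕ-mod (<⇒≤ k<n))) (sym (toℕ-mod k<n)) , back , blocked refl)
    where
    back : at (suc k) ⟶ at k
    back = [ (λ arc → contradiction arc (blocked refl)) , (λ arc → arc) ]′ (consecutive⇒adjacent k<n)

  RightBlocked⇒V₊ : ∀ {k} → k < n → RightBlocked k → V₊ D v (at k)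
  RightBlocked⇒V₊ {k} k<n blocked with m≤n⇒m<n∨m≡n k<n
  ... | inj₂ k+1≡n = k mod n , refl , inj₁ (trans (cong suc (toℕ-mod k<n)) k+1≡n)
  ... | inj₁ k+1<n = k mod n , refl ,
      inj₂ (suc k mod n , trans (toℕ-mod k+1<n) (cong suc (sym (toℕ-mod k<n))) , forth , blocked k+1<n)
    where
    forth : at k ⟶ at (suc k)
    forth = [ (λ arc → arc) , (λ arc → contradiction arc (blocked k+1<n)) ]′ (consecutive⇒adjacent k+1<n)

  gap⁺ : ∀ {j i} → i < n → j ≤ i → LeftBlocked j → RightBlocked i → Gap D v (i ∸ j)
  gap⁺ {j} {i} i<n j≤i lb rb = j mod n , i mod n ,
    LeftBlocked⇒V₋ j<n lb , RightBlocked⇒V₊ i<n rb ,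
    subst (_≤ toℕ (i mod n)) (sym (toℕ-mod j<n)) (subst (j ≤_) (sym (toℕ-mod i<n)) j≤i) ,
    sym (cong₂ _∸_ (toℕ-mod i<n) (toℕ-mod j<n))
    where
    j<n : j < n
    j<n = ≤-<-trans j≤i i<n

  gap⁻ : ∀ {d} → Gap D v d → ∃[ j ] (d + j < n × LeftBlocked j × RightBlocked (d + j))
  gap⁻ (j , i , v₋ , v₊ , j≤i , refl) = toℕ j ,
    subst (λ k → k < n × LeftBlocked (toℕ j) × RightBlocked k) (sym (m∸n+n≡m j≤i))
      (toℕ<n i , V₋⇒LeftBlocked v₋ , V₊⇒RightBlocked v₊)

  -- Lower bound on forts

  module _ {W : Subset n} (fort : Fort D W) where

    -- The walk to the right stops at the first visited position that is blocked. Each move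
    -- increases `k`, and `gas` bounds the number of moves left.
    rightmost : ∀ gas {k} → n ≤ gas + k → k < n → at k ∈ W →
      ∃[ i ] (i < n × at i ∈ W × RightBlocked i)
    rightmost zero n≤k k<n _ = contradiction n≤k (<⇒≱ k<n)
    rightmost (suc gas) {k} n≤ k<n k∈W with suc k <? n
    ... | no k+1≮n = k , k<n , k∈W , (λ k+1<n → contradiction k+1<n k+1≮n)
    ... | yes k+1<n with at (suc k) ⟶? at k
    ...   | no ¬arc = k , k<n , k∈W , (λ _ → ¬arc)
    ...   | yes arc with at (suc k) ∈? W
    ...     | yes k+1∈W = rightmost gas (subst (n ≤_) (sym (+-suc gas k)) n≤) k+1<n k+1∈W
    -- `at (suc k)` has the out-neighbour `at k` in `W`, so it has another one there, which can only
    -- be its right neighbour.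
    ...     | no k+1∉W with fort k+1∉W arc k∈W
    ...       | y , y≢ , arc′ , y∈W with locate y
    ...         | m , m<n , refl with adjacent⇒consecutive k+1<n m<n (inj₁ arc′)
    ...           | inj₂ refl = contradiction refl y≢
    ...           | inj₁ refl = rightmost gas n≤′ m<n y∈W
      where
      n≤′ : n ≤ gas + suc (suc k)
      n≤′ = ≤-trans n≤ (≤-trans (n≤1+n _) (≤-reflexive (sym (m+2+n≡2+m+n gas k))))

    initial? : ∀ k → Decidable₁ (λ x → x ∈ W × pos x < suc k)
    initial? k x = (x ∈? W) ×-dec (pos x <? suc k)

    initial : ℕ → Subset n
    initial k = comprehension (initial? k)

    at∈initial : ∀ {k} → k < n → at k ∈ W → at k ∈ initial k
    at∈initial {k} k<n k∈W = ∈-comprehension⁺ (initial? k) (k∈W , s≤s (≤-reflexive (pos-at k<n)))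

    initial-grows : ∀ {l k} → l < k → k < n → at k ∈ W → ∣ initial l ∣ < ∣ initial k ∣
    initial-grows {l} {k} l<k k<n k∈W = p⊂q⇒∣p∣<∣q∣ (sub , at k , at∈initial k<n k∈W , k∉)
      where
      sub : initial l ⊆ initial k
      sub x∈ with ∈-comprehension⁻ (initial? l) x∈
      ... | x∈W , x≤l = ∈-comprehension⁺ (initial? k) (x∈W , ≤-trans x≤l (m≤n⇒m≤1+n l<k))
      k∉ : at k ∉ initial l
      k∉ k∈ = <⇒≱ l<k (s≤s⁻¹ (subst (_< suc l) (pos-at k<n) (proj₂ (∈-comprehension⁻ (initial? l) k∈))))

    -- The invariant of the walk to the left. Only elements up to position `k` are counted, so that
    -- a later, larger position always contributes a new one.
    LeftReach : ℕ → Set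
    LeftReach k = ∃₂ λ j d → d + j ≡ k × LeftBlocked j × suc ⌈ d /2⌉ ≤ ∣ initial k ∣

    blocked-reach : ∀ {k} → k < n → at k ∈ W → LeftBlocked k → LeftReach k
    blocked-reach {k} k<n k∈W lb =
      -- Removing `at k` strictly shrinks `initial k`, whose size is therefore positive.
      k , 0 , refl , lb , ≤-<-trans z≤n (x∈p⇒∣p-x∣<∣p∣ (at∈initial k<n k∈W))

    -- One new element of `W` pays for a move of length one or two, since `⌈ d /2⌉` rises by at most
    -- one when `d` grows by two.
    step₁ : ∀ {k} → suc k < n → at (suc k) ∈ W → LeftReach k → LeftReach (suc k)
    step₁ k<n k∈W (j , d , refl , lb , le) = j , suc d , refl , lb ,
      ≤-trans (s≤s (s≤s (⌊n/2⌋≤⌈n/2⌉ d))) (≤-<-trans le (initial-grows (n<1+n _) k<n k∈W))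

    step₂ : ∀ {k} → suc (suc k) < n → at (suc (suc k)) ∈ W → LeftReach k → LeftReach (suc (suc k))
    step₂ k<n k∈W (j , d , refl , lb , le) = j , suc (suc d) , refl , lb ,
      ≤-<-trans le (initial-grows (m<n⇒m<1+n (n<1+n _)) k<n k∈W)

    -- This mirrors `rightmost`: an unblocked position has its left neighbour in `W`, or else the
    -- fort condition at that neighbour yields the position two to the left.
    leftReach : ∀ k → k < n → at k ∈ W → LeftReach k
    leftReach zero k<n k∈W = blocked-reach k<n k∈W λ ()
    leftReach (suc k) k<n k∈W with at k ⟶? at (suc k)
    ... | no ¬arc = blocked-reach k<n k∈W λ { refl → ¬arc }
    ... | yes arc with at k ∈? W
    ...   | yes k′∈W = step₁ k<n k∈W (leftReach k (<⇒≤ k<n) k′∈W)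
    ...   | no k′∉W with fort k′∉W arc k∈W
    ...     | y , y≢ , arc′ , y∈W with locate y
    ...       | m , m<n , refl with adjacent⇒consecutive (<⇒≤ k<n) m<n (inj₁ arc′)
    ...         | inj₁ refl = contradiction refl y≢
    ...         | inj₂ refl = step₂ k<n k∈W (leftReach m m<n y∈W)

    fort-size : ∀ {ℓ x} → (∀ d → Gap D v d → ℓ ≤ d) → x ∈ W → suc ⌈ ℓ /2⌉ ≤ ∣ W ∣
    fort-size {ℓ} {x} minimal x∈W with locate x
    ... | k , k<n , refl with rightmost n (m≤m+n n k) k<n x∈W
    ...   | i , i<n , i∈W , rb with leftReach i i<n i∈W
    -- The two walks end at blocked positions `j` and `d + j`, so `d` is itself a gap and at least
    -- `ℓ`.
    ...     | j , d , refl , lb , le = ≤-trans (s≤s (⌈n/2⌉-mono ℓ≤d))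
                (≤-trans le (p⊆q⇒∣p∣≤∣q∣ (proj₁ ∘ ∈-comprehension⁻ (initial? i))))
      where
      ℓ≤d : ℓ ≤ d
      ℓ≤d = subst (ℓ ≤_) (m+n∸n≡m d j) (minimal _ (gap⁺ i<n (m≤n+m j d) lb rb))

  -- The optimal fort

  -- For odd `d` every second position from `j` would miss `d + j`; the base case `suc zero` puts it
  -- in, so both ends always belong.
  comb : ℕ → ℕ → Subset n
  comb zero          j = ⁅ at j ⁆
  comb (suc zero)    j = ⁅ at j ⁆ ∪ ⁅ at (suc j) ⁆
  comb (suc (suc d)) j = ⁅ at j ⁆ ∪ comb d (suc (suc j))

  ∣comb∣≤ : ∀ d j → ∣ comb d j ∣ ≤ suc ⌈ d /2⌉
  ∣comb∣≤ zero j = ≤-reflexive (∣⁅x⁆∣≡1 (at j))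
  ∣comb∣≤ (suc zero) j = ≤-trans (∣p∪q∣≤∣p∣+∣q∣ ⁅ at j ⁆ _)
    (≤-reflexive (cong₂ _+_ (∣⁅x⁆∣≡1 (at j)) (∣⁅x⁆∣≡1 (at (suc j)))))
  ∣comb∣≤ (suc (suc d)) j = ≤-trans (∣p∪q∣≤∣p∣+∣q∣ ⁅ at j ⁆ _)
    (+-mono-≤ (≤-reflexive (∣⁅x⁆∣≡1 (at j))) (∣comb∣≤ d (suc (suc j))))

  comb-first : ∀ d j → at j ∈ comb d j
  comb-first zero          j = x∈⁅x⁆ _
  comb-first (suc zero)    j = p⊆p∪q _ (x∈⁅x⁆ _)
  comb-first (suc (suc d)) j = p⊆p∪q _ (x∈⁅x⁆ _)

  comb-last : ∀ d j → at (d + j) ∈ comb d j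
  comb-last zero          j = x∈⁅x⁆ _
  comb-last (suc zero)    j = q⊆p∪q ⁅ at j ⁆ _ (x∈⁅x⁆ _)
  comb-last (suc (suc d)) j = q⊆p∪q ⁅ at j ⁆ _
    (subst (λ k → at k ∈ comb d (suc (suc j)))
      (m+2+n≡2+m+n d j) (comb-last d (suc (suc j))))

  comb-range : ∀ d j {x} → x ∈ comb d j → ∃[ k ] (x ≡ at k × j ≤ k × k ≤ d + j)
  comb-range zero j x∈ = j , x∈⁅y⁆⇒x≡y _ x∈ , ≤-refl , ≤-refl
  comb-range (suc zero) j x∈ with x∈p∪q⁻ ⁅ at j ⁆ _ x∈
  ... | inj₁ x∈j  = j , x∈⁅y⁆⇒x≡y _ x∈j , ≤-refl , n≤1+n j
  ... | inj₂ x∈j′ = suc j , x∈⁅y⁆⇒x≡y _ x∈j′ , n≤1+n j , ≤-refl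
  comb-range (suc (suc d)) j x∈ with x∈p∪q⁻ ⁅ at j ⁆ _ x∈
  ... | inj₁ x∈j = j , x∈⁅y⁆⇒x≡y _ x∈j , ≤-refl , m≤n+m j (suc (suc d))
  ... | inj₂ x∈r with comb-range d (suc (suc j)) x∈r
  ...   | k , eq , j≤k , k≤ = k , eq , ≤-trans (m≤n+m j 2) j≤k ,
            ≤-trans k≤ (≤-reflexive (m+2+n≡2+m+n d j))

  -- Used for a vertex between the ends and outside the comb: both its neighbours must then be in
  -- the comb.
  comb-dense : ∀ d j {k} → j ≤ k → k < d + j → at k ∈ comb d j ⊎ at (suc k) ∈ comb d j
  comb-dense zero j j≤k k<j = contradiction j≤k (<⇒≱ k<j)
  comb-dense (suc d) j j≤k k< with m≤n⇒m<n∨m≡n j≤k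
  comb-dense (suc d) j j≤k k< | inj₂ refl = inj₁ (comb-first (suc d) j)
  comb-dense (suc zero) j j≤k k< | inj₁ j<k = contradiction j<k (<⇒≱ k<)
  comb-dense (suc (suc d)) j j≤k k< | inj₁ j<k with m≤n⇒m<n∨m≡n j<k
  ... | inj₂ refl = inj₂ (q⊆p∪q ⁅ at j ⁆ _ (comb-first d (suc (suc j))))
  ... | inj₁ j+1<k with comb-dense d (suc (suc j)) j+1<k
                          (<-≤-trans k< (≤-reflexive (sym (m+2+n≡2+m+n d j))))
  ...   | inj₁ k∈  = inj₁ (q⊆p∪q ⁅ at j ⁆ _ k∈)
  ...   | inj₂ k′∈ = inj₂ (q⊆p∪q ⁅ at j ⁆ _ k′∈)

  module _ {d j} (d+j<n : d + j < n) (lb : LeftBlocked j) (rb : RightBlocked (d + j))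
           (minimal : ∀ d′ → Gap D v d′ → d ≤ d′) where

    -- If the forward arc were missing, `suc k` would be left-blocked and could replace `j`; if the
    -- backward arc were missing, `k` would be right-blocked and could replace `d + j`. Either gap
    -- is shorter than `d`.
    bidirectional : ∀ {k} → j ≤ k → k < d + j → at k ⟶ at (suc k) × at (suc k) ⟶ at k
    bidirectional {k} j≤k k<i = forth , back
      where
      forth : at k ⟶ at (suc k)
      forth with at k ⟶? at (suc k)
      ... | yes arc = arc
      ... | no ¬arc = contradiction (minimal _ (gap⁺ d+j<n k<i (λ { refl → ¬arc }) rb))
              (<⇒≱ (<-≤-trans (∸-monoʳ-< (s≤s j≤k) k<i) (≤-reflexive (m+n∸n≡m d j))))
      back : at (suc k) ⟶ at k
      back with at (suc k) ⟶? at k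
      ... | yes arc = arc
      ... | no ¬arc = contradiction (minimal _ (gap⁺ (<-trans k<i d+j<n) j≤k lb (λ _ → ¬arc)))
              (<⇒≱ (subst (k ∸ j <_) (m+n∸n≡m d j) (∸-monoˡ-< k<i j≤k)))

    -- No arc enters the comb from beyond its blocked ends. So `u` lies strictly between the ends,
    -- and its neighbour on the side away from `x` is the second out-neighbour required.
    comb-fort : Fort D (comb d j)
    comb-fort {u} {x} u∉ u⟶x x∈ with locate u | comb-range d j x∈
    ... | k , k<n , refl | l , refl , j≤l , l≤i
      with adjacent⇒consecutive k<n (≤-<-trans l≤i d+j<n) (inj₁ u⟶x)
    ... | inj₁ refl = from-left (m≤n⇒m<n∨m≡n j≤l)
      where
      from-left : j < suc k ⊎ j ≡ suc k → ∃[ y ] (y ≢ at (suc k) × at k ⟶ y × y ∈ comb d j)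
      from-left (inj₂ j≡k+1) = contradiction (subst (λ m → at k ⟶ at m) (sym j≡k+1) u⟶x) (lb j≡k+1)
      from-left (inj₁ j<k+1) with m≤n⇒m<n∨m≡n (s≤s⁻¹ j<k+1)
      ... | inj₂ refl = contradiction (comb-first d j) u∉
      -- Matching on `j < k` exposes `k` as `suc k′`, and `at k′` is the neighbour opposite to `x`.
      ... | inj₁ (s≤s {n = k′} j≤k′) = at k′ ,
              (λ eq → <-irrefl (at-injective (<⇒≤ k<n) (≤-<-trans l≤i d+j<n) eq) (m<n⇒m<1+n (n<1+n k′))) ,
              proj₂ (bidirectional j≤k′ (<⇒≤ l≤i)) ,
              [ (λ k′∈ → k′∈) , (λ k∈ → contradiction k∈ u∉) ]′ (comb-dense d j j≤k′ (<⇒≤ l≤i))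
    ... | inj₂ refl = from-right (m≤n⇒m<n∨m≡n l≤i)
      where
      from-right : l < d + j ⊎ l ≡ d + j → ∃[ y ] (y ≢ at l × at (suc l) ⟶ y × y ∈ comb d j)
      from-right (inj₂ refl) = contradiction u⟶x (rb k<n)
      from-right (inj₁ l<i) with m≤n⇒m<n∨m≡n l<i
      ... | inj₂ eq = contradiction (subst (λ m → at m ∈ comb d j) (sym eq) (comb-last d j)) u∉
      ... | inj₁ l+1<i = at (suc (suc l)) ,
              (λ eq → <-irrefl (at-injective (<⇒≤ k<n) (≤-<-trans l+1<i d+j<n) (sym eq)) (m<n⇒m<1+n (n<1+n l))) ,
              proj₁ (bidirectional (m≤n⇒m≤1+n j≤l) l+1<i) ,
              [ (λ k∈ → contradiction k∈ u∉) , (λ m∈ → m∈) ]′ (comb-dense d j (m≤n⇒m≤1+n j≤l) l+1<i)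

-- The failed zero forcing number of a weak path

theorem4p5 : ∀ (n : ℕ) .{{_ : NonZero n}} (D : Digraph n) (v : Permutation′ n) →
    IsWeakPath D v →
    ∀ (ℓ : ℕ) → IsMinimum (Gap D v) ℓ →
    IsFailedZeroForcingNumber D (n ∸ 1 ∸ ⌈ ℓ /2⌉)
theorem4p5 n D v path ℓ (gap , minimal)
  -- The target becomes `n ∸ suc ⌈ ℓ /2⌉`, with the least fort size subtracted at once.
  rewrite ∸-+-assoc n 1 ⌈ ℓ /2⌉ with WeakPath.gap⁻ D v path gap
... | j , ℓ+j<n , lb , rb =
      -- `∁ W` is itself a failed set, so `upper` supplies one half of the equality for its size.
      (∁ W , W-FZFS , ≤-antisym (upper (∁ W) W-FZFS) W-large) ,
      (λ { _ (S , fzfs , refl) → upper S fzfs })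
  where
  open WeakPath D v path
  -- A failed set is contained in the stalled set it generates, which is not `⊤`; its complement is
  -- a nonempty fort, to which `fort-size` applies.
  upper : ∀ S → IsFZFS D S → ∣ S ∣ ≤ n ∸ suc ⌈ ℓ /2⌉
  upper S fzfs with stalls D S
  ... | s , stalled with ≢⊤⇒∁-nonempty (λ eq → fzfs (s , eq))
  ...   | x , x∈ = begin
    ∣ S ∣                  ≤⟨ p⊆q⇒∣p∣≤∣q∣ (S⊆B D s) ⟩
    ∣ B D s S ∣            ≡⟨ m∸[m∸n]≡n (∣p∣≤n (B D s S)) ⟨
    n ∸ (n ∸ ∣ B D s S ∣)  ≡⟨ cong (n ∸_) (∣∁p∣≡n∸∣p∣ (B D s S)) ⟨
    n ∸ ∣ ∁ (B D s S) ∣    ≤⟨ ∸-monoʳ-≤ n (fort-size (stalled⇒fort D stalled) minimal x∈) ⟩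
    n ∸ suc ⌈ ℓ /2⌉        ∎
    where open ≤-Reasoning
  W : Subset n
  W = comb ℓ j
  W-FZFS : IsFZFS D (∁ W)
  W-FZFS = fort⇒FZFS D (comb-fort ℓ+j<n lb rb minimal) (comb-first ℓ j)
  W-large : n ∸ suc ⌈ ℓ /2⌉ ≤ ∣ ∁ W ∣
  W-large = ≤-trans (∸-monoʳ-≤ n (∣comb∣≤ ℓ j)) (≤-reflexive (sym (∣∁p∣≡n∸∣p∣ W)))
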